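{- For any integer $n\ge 1$, $H_n$ is a convex, polyhedral cone, given by $H_n=H_{m(n),n}$.
   Context: For a positive integer $k$ let $[k]=\{1,\dots,k\}$. $K_N$ is the undirected complete graph on vertex set $[N]$, with edge set $E_N=\{(i,j):1\le i<j\le N\}$. A weight map is a function $w:E_N\to\mathbb{R}_{\ge 0}$. For $W\subseteq[N]$, the cut $C(W)$ is the set of edges with exactly one endpoint in $W$, and $\|C(W)\|$ is the sum of the weights of its edges. For integers $1\le n<N$, the vertices in $[n]$ of $K_N$ are called terminals, vertex $N$ is the sink. Given $w$ on $K_N$, for each $\varnothing\ne I\subseteq[n]$ set $$S_I=\min\{\|C(W)\| : W\subseteq[N-1],\ W\cap[n]=I\}.$$ The resulting vector $S=(S_I)_{\varnothing\ne I\subseteq[n]}\in\mathbb{R}^{2^n-1}$ is said to be realized by $w$ in $K_N$. $H_n$ is the set of all $S\in\mathbb{R}^{2^n-1}$ realized by some weight map in $K_N$ for some $N>n$. For $N>n$, $H_{N,n}$ is the convex hull of the set of all $S\in\mathbb{R}^{2^n-1}$ realized by some weight map in $K_N$ (for this fixed $N$). The integer $m(n)$ is the smallest integer such that every $S\in H_n$ can be realized in $K_{m(n)}$ (such an integer exists). -}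

module Defs where

open import Algebra.Bundles using (CommutativeRing)
open import Data.Fin.Base using (Fin; toℕ; inject≤; _<_)
open import Data.Fin.Properties using (_<?_)
open import Data.Fin.Subset using (Subset; inside; outside; _∈_; _∉_; Nonempty)
open import Data.Fin.Subset.Properties using (_∈?_; nonempty?)
open import Data.Irrelevant using ([_])
open import Data.Nat.Base as ℕ using (ℕ; zero; suc)
open import Data.Nat.Properties using (<⇒≤)
open import Data.Product.Base using (∃; ∃-syntax; Σ-syntax; _×_; _,_; proj₁; proj₂)
open import Data.Refinement using (Refinement-syntax; _,_; value)
open import Data.Sum.Base using (_⊎_)
open import Data.Vec.Base using ([]; _∷_)
open import Function.Bundles using (_⇔_)
open import Level using (Level; _⊔_; 0ℓ) renaming (suc to lsuc)
open import Relation.Binary.Core using (Rel)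
open import Relation.Binary.Structures using (IsDecTotalOrder)
open import Relation.Nullary using (¬_; Dec; yes; no)
open import Relation.Nullary.Decidable using (¬?; _×-dec_; _⊎-dec_)
open import Relation.Unary as U using (Pred; _≐_)

record OrderedField c ℓ₁ ℓ₂ : Set (lsuc (c ⊔ ℓ₁ ⊔ ℓ₂)) where
  infix 4 _≤_
  field
    commutativeRing : CommutativeRing c ℓ₁
  open CommutativeRing commutativeRing public
  field
    _≤_             : Rel Carrier ℓ₂
    isDecTotalOrder : IsDecTotalOrder _≈_ _≤_
    1≉0             : ¬ (1# ≈ 0#)
    inverse         : ∀ x → ¬ (x ≈ 0#) → ∃[ y ] x * y ≈ 1#
    +-monoˡ-≤       : ∀ {x y} z → x ≤ y → x + z ≤ y + z
    *-nonNeg        : ∀ {x y} → 0# ≤ x → 0# ≤ y → 0# ≤ x * y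

  UpperBound : ∀ {p} → Pred Carrier p → Pred Carrier (c ⊔ ℓ₂ ⊔ p)
  UpperBound P b = ∀ x → P x → x ≤ b

-- Classically, the complete ordered fields are exactly the copies of ℝ.
record CompleteOrderedField c ℓ₁ ℓ₂ : Set (lsuc (c ⊔ ℓ₁ ⊔ ℓ₂)) where
  field
    orderedField : OrderedField c ℓ₁ ℓ₂
  open OrderedField orderedField public
  field
    supremum : ∀ (P : Pred Carrier (c ⊔ ℓ₁ ⊔ ℓ₂)) → ∃ P → ∃ (UpperBound P) →
               ∃[ s ] UpperBound P s × (∀ b → UpperBound P b → s ≤ b)

-- In Fin N, the number v stands for the vertex suc (toℕ v) of [N].
Edge : ℕ → Set
Edge N = [ e ∈ Fin N × Fin N ∣ proj₁ e < proj₂ e ]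

C⟨_⟩ : ∀ {N} → Subset N → Pred (Edge N) 0ℓ
C⟨ W ⟩ e = let (i , j) = value e in (i ∈ W × j ∉ W) ⊎ (i ∉ W × j ∈ W)

_∈C?⟨_⟩ : ∀ {N} (e : Edge N) (W : Subset N) → Dec (C⟨ W ⟩ e)
e ∈C?⟨ W ⟩ = let (i , j) = value e in
  ((i ∈? W) ×-dec ¬? (j ∈? W)) ⊎-dec (¬? (i ∈? W) ×-dec (j ∈? W))

-- W ⊆ [N-1] and W ∩ [n] = I.
record Separates {n N} (n<N : n ℕ.< N) (I : Subset n) (W : Subset N) : Set where
  field
    avoids-sink : ∀ v → v ∈ W → suc (toℕ v) ℕ.≤ N ℕ.∸ 1
    terminals   : ∀ (i : Fin n) → inject≤ i (<⇒≤ n<N) ∈ W ⇔ i ∈ I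

-- The nonemptiness proof is irrelevant, so that each I indexes one coordinate.
NonemptySubset : ℕ → Set
NonemptySubset n = [ I ∈ Subset n ∣ Nonempty I ]

module MinCuts {c ℓ₁ ℓ₂} (ℝ : OrderedField c ℓ₁ ℓ₂) where
  open OrderedField ℝ
  open import Algebra.Definitions.RawMonoid +-rawMonoid using (sum)

  private
    variable
      p  : Level
      n N : ℕ

  _when_ : {P : Set p} → (.P → Carrier) → Dec P → Carrier
  f when yes x = f x
  f when no  _ = 0#

  ∑-edges : (Edge N → Carrier) → Carrier
  ∑-edges f = sum λ i → sum λ j → (λ i<j → f ((i , j) , [ i<j ])) when (i <? j)

  ∑-subsets : ∀ n → (Subset n → Carrier) → Carrier
  ∑-subsets zero    f = f []
  ∑-subsets (suc n) f =
    ∑-subsets n (λ I → f (outside ∷ I)) + ∑-subsets n (λ I → f (inside ∷ I))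

  record WeightMap (N : ℕ) : Set (c ⊔ ℓ₂) where
    field
      weight : Edge N → Carrier
      nonNeg : ∀ e → 0# ≤ weight e

  ‖C_⟨_⟩‖ : WeightMap N → Subset N → Carrier
  ‖C w ⟨ W ⟩‖ = ∑-edges λ e → (λ _ → WeightMap.weight w e) when (e ∈C?⟨ W ⟩)

  ℝ^ : ℕ → Set c
  ℝ^ n = NonemptySubset n → Carrier

  IsMinOf : {A : Set} → (A → Carrier) → Pred A 0ℓ → Pred Carrier (ℓ₁ ⊔ ℓ₂)
  IsMinOf f P m = (∃[ a ] P a × m ≈ f a) × (∀ a → P a → m ≤ f a)

  Realizes : n ℕ.< N → WeightMap N → Pred (ℝ^ n) (ℓ₁ ⊔ ℓ₂)
  Realizes n<N w S = ∀ I → IsMinOf ‖C w ⟨_⟩‖ (Separates n<N (value I)) (S I)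

  Realizable : n ℕ.< N → Pred (ℝ^ n) (c ⊔ ℓ₁ ⊔ ℓ₂)
  Realizable {N = N} n<N S = Σ[ w ∈ WeightMap N ] Realizes n<N w S

  H : ∀ n → Pred (ℝ^ n) (c ⊔ ℓ₁ ⊔ ℓ₂)
  H n S = Σ[ N ∈ ℕ ] Σ[ n<N ∈ n ℕ.< N ] Realizable n<N S

  ConvexHull : Pred (ℝ^ n) p → Pred (ℝ^ n) (c ⊔ ℓ₁ ⊔ ℓ₂ ⊔ p)
  ConvexHull {n = n} X x =
    Σ[ k ∈ ℕ ] Σ[ t ∈ (Fin k → Carrier) ] Σ[ y ∈ (Fin k → ℝ^ n) ]
      (∀ i → 0# ≤ t i) × sum t ≈ 1# × (∀ i → X (y i)) ×
      (∀ I → x I ≈ sum λ i → t i * y i I)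

  H[_,_] : ∀ N n → n ℕ.< N → Pred (ℝ^ n) (c ⊔ ℓ₁ ⊔ ℓ₂)
  H[ N , n ] n<N = ConvexHull (Realizable n<N)

  -- The defining property of the integer m(n).
  record Is-m⟨_⟩ (n m : ℕ) : Set (c ⊔ ℓ₁ ⊔ ℓ₂) where
    field
      n<m      : n ℕ.< m
      realizes : H n U.⊆ Realizable n<m
      least    : ∀ {k} (n<k : n ℕ.< k) → H n U.⊆ Realizable n<k → m ℕ.≤ k

  ⟪_,_⟫ : ℝ^ n → ℝ^ n → Carrier
  ⟪_,_⟫ {n = n} a x =
    ∑-subsets n λ I → (λ I≢∅ → a (I , [ I≢∅ ]) * x (I , [ I≢∅ ])) when nonempty? I

  Convex : Pred (ℝ^ n) p → Set (c ⊔ ℓ₂ ⊔ p)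
  Convex X = ∀ {x y} t → X x → X y → 0# ≤ t → t ≤ 1# →
             X (λ I → t * x I + (1# - t) * y I)

  Cone : Pred (ℝ^ n) p → Set (c ⊔ ℓ₂ ⊔ p)
  Cone X = ∃ X × (∀ {x} t → 0# ≤ t → X x → X (λ I → t * x I))

  -- A polyhedral cone: the constraints are homogeneous linear inequalities.
  Polyhedral : Pred (ℝ^ n) p → Set (c ⊔ ℓ₂ ⊔ p)
  Polyhedral {n = n} X =
    Σ[ k ∈ ℕ ] Σ[ a ∈ (Fin k → ℝ^ n) ] X ≐ (λ x → ∀ i → 0# ≤ ⟪ a i , x ⟫)

  record IsConvexPolyhedralCone (X : Pred (ℝ^ n) p) : Set (c ⊔ ℓ₂ ⊔ p) where
    field
      convex     : Convex X
      cone       : Cone X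
      polyhedral : Polyhedral X

{-# OPTIONS --safe #-}
module Submission where

-- Fix a minimum cut for every I and merge the vertices of a network that lie in
-- the same chosen cuts. Nothing is lost, so every S in H_n is realized by a
-- network on one fixed vertex set whose minimum cuts are known in advance. Being
-- realized by weights w with prescribed minimum cuts is a system of homogeneous
-- linear inequalities in (w, S), so H_n is a projection of a polyhedral cone, and
-- Fourier–Motzkin elimination of w makes it polyhedral. Polyhedral cones are
-- closed under nonnegative combinations, which gives the remaining claims.

open import Defs
open import Data.Nat.Base using (ℕ; _≤_)
open import Data.Product.Base using (_×_)
open import Relation.Unary using (_≐_)

import Algebra.Properties.AbelianGroup as AbelianGroupProperties
import Algebra.Properties.CommutativeSemigroup as CommutativeSemigroupProperties
import Algebra.Properties.Ring as RingProperties
import Algebra.Properties.Semiring.Sum as SemiringSum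
open import Data.Bool.Base using (Bool; true; false)
import Data.Bool.Properties as Bool
open import Data.Fin.Base as Fin using (Fin; zero; suc; toℕ; fromℕ<; inject≤; _↑ˡ_; _↑ʳ_; combine; remQuot;
  splitAt; punchIn; funToFin; finToFun)
import Data.Fin.Properties as Fin
open import Data.Fin.Subset using (Subset; inside; outside; _∈_; _∉_; Nonempty; ⊥)
open import Data.Fin.Subset.Properties using (_∈?_; nonempty?)
open import Data.Irrelevant using ([_])
open import Data.Nat.Base as ℕ using (zero; suc; _∸_; _^_)
import Data.Nat.Properties as ℕ
open import Data.Product.Base using (∃; ∃-syntax; Σ-syntax; _,_; proj₁; proj₂; uncurry)
open import Data.Refinement using (_,_; value)
open import Data.Sum.Base using (_⊎_; inj₁; inj₂)
open import Data.Vec.Base as Vec using ([]; _∷_; lookup; tabulate)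
import Data.Vec.Functional as Vector
import Data.Vec.Functional.Properties as Vector
import Data.Vec.Properties as Vec
open import Function.Base using (_∘_; const)
open import Function.Bundles using (_⇔_; mk⇔; Equivalence; Inverse)
open import Level using (Level; _⊔_)
open import Relation.Binary.PropositionalEquality as ≡ using (_≡_; _≢_)
open import Relation.Binary.Structures using (IsDecTotalOrder)
import Relation.Binary.Reasoning.Setoid as SetoidReasoning
open import Relation.Nullary using (¬_; Dec; yes; no; contradiction)
open import Relation.Nullary.Negation using (contradiction-irr)
open import Relation.Nullary.Decidable using (¬?; _×-dec_; _→-dec_; map′)
open import Relation.Unary using (Pred; _⊆_)

open Equivalence using (to; from)

-- A minimum is not linear in the weights. Asking only that each `S I` be the least cut value gives
-- one polyhedron for every way of attaining the minima, and a union of polyhedra need not be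
-- convex. With the minimum cuts prescribed, what remains is a single conjunction of linear
-- inequalities. Merging also bounds the number of vertices: a non-terminal other than the sink
-- matters only through the family of those I whose chosen cut contains it, and there are
-- `2 ^ (2 ^ n)` families. The resulting `order n` is not claimed to be m(n). The statement about
-- m(n) holds because any convex combination of vectors of `H n` stays in `H n`.

private
  variable
    k n N : ℕ

-- Numerical codes for subsets and for families of subsets

-- Serves twice: labels are coded families of subsets, and a quantifier over subsets becomes a
-- quantifier over `Fin`.
encode : Subset k → Fin (2 ^ k)
encode I = funToFin (λ i → Inverse.from Fin.2↔Bool (lookup I i))

decode : Fin (2 ^ k) → Subset k
decode a = tabulate (λ i → Inverse.to Fin.2↔Bool (finToFun a i))

decode-encode : (I : Subset k) → decode (encode I) ≡ I
decode-encode I = ≡.trans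
  (Vec.tabulate-cong λ i → ≡.trans
    (≡.cong (Inverse.to Fin.2↔Bool) (Fin.finToFun-funToFin (λ i → Inverse.from Fin.2↔Bool (lookup I i)) i))
    (Inverse.strictlyInverseˡ Fin.2↔Bool (lookup I i)))
  (Vec.tabulate∘lookup I)

-- Two rounds of coding: a family of subsets of [n] is a subset of the `2 ^ n` codes, which is coded
-- again.
Label : ℕ → Set
Label n = Fin (2 ^ (2 ^ n))

_contains_ : Label n → Subset n → Bool
l contains I = lookup (decode l) (encode I)

label : (Subset n → Bool) → Label n
label f = encode (tabulate (f ∘ decode))

label-contains : (f : Subset n → Bool) (I : Subset n) → label f contains I ≡ f I
label-contains f I = begin
  lookup (decode (label f)) (encode I)         ≡⟨ ≡.cong (λ p → lookup p (encode I)) (decode-encode (tabulate (f ∘ decode))) ⟩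
  lookup (tabulate (f ∘ decode)) (encode I)    ≡⟨ Vec.lookup∘tabulate (f ∘ decode) (encode I) ⟩
  f (decode (encode I))                        ≡⟨ ≡.cong f (decode-encode I) ⟩
  f I                                          ∎
  where open ≡.≡-Reasoning

-- Separating sets as bit vectors

module _ {n N : ℕ} (n<N : n ℕ.< N) where

  private
    terminal : Fin n → Fin N
    terminal i = inject≤ i (ℕ.<⇒≤ n<N)

  IsSink : Fin N → Set
  IsSink v = toℕ v ≡ N ∸ 1

  sink≮ : ∀ v → IsSink v → ¬ (suc (toℕ v) ≤ N ∸ 1)
  sink≮ v eq v<s = ℕ.<-irrefl eq v<s

  module _ {I : Subset n} {W : Subset N} where

    -- Every vertex number is at most `N ∸ 1`, so the strict bound in `avoids-sink` excludes just
    -- the sink. In this form both conditions are equations between bits, which are decidable and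
    -- easy to transport.
    separates⁺ : (∀ v → IsSink v → lookup W v ≡ outside) →
                 (∀ i → lookup W (terminal i) ≡ lookup I i) → Separates n<N I W
    separates⁺ sink term = record
      { avoids-sink = λ v v∈W → ℕ.≤∧≢⇒< (Fin.toℕ≤pred[n]′ v)
          λ eq → contradiction (≡.trans (≡.sym (Vec.[]=⇒lookup v∈W)) (sink v eq)) λ ()
      ; terminals = λ i → mk⇔
          (λ t∈W → Vec.lookup⇒[]= i I (≡.trans (≡.sym (term i)) (Vec.[]=⇒lookup t∈W)))
          (λ i∈I → Vec.lookup⇒[]= (terminal i) W (≡.trans (term i) (Vec.[]=⇒lookup i∈I)))
      }

    separates⁻-sink : Separates n<N I W → ∀ v → IsSink v → lookup W v ≡ outside
    separates⁻-sink sep v eq = Bool.¬-not λ in-W →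
      sink≮ v eq (Separates.avoids-sink sep v (Vec.lookup⇒[]= v W in-W))

    separates⁻-terminal : Separates n<N I W → ∀ i → lookup W (terminal i) ≡ lookup I i
    separates⁻-terminal sep i = go _ _ ≡.refl ≡.refl
      where
      term = Separates.terminals sep i
      go : ∀ b b′ → lookup W (terminal i) ≡ b → lookup I i ≡ b′ → lookup W (terminal i) ≡ lookup I i
      go true  _     e _  = ≡.trans e (≡.sym (Vec.[]=⇒lookup (to term (Vec.lookup⇒[]= _ W e))))
      go false true  _ e′ = ≡.trans (Vec.[]=⇒lookup (from term (Vec.lookup⇒[]= _ I e′))) (≡.sym e′)
      go false false e e′ = ≡.trans e (≡.sym e′)

  -- Allows `Separates` to guard an inequality inside a finite system.
  separates? : (I : Subset n) (W : Subset N) → Dec (Separates n<N I W)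
  separates? I W = map′ (uncurry separates⁺) (λ sep → separates⁻-sink sep , separates⁻-terminal sep)
    (Fin.all? (λ v → (toℕ v ℕ.≟ N ∸ 1) →-dec (lookup W v Bool.≟ outside)) ×-dec
     Fin.all? (λ i → lookup W (terminal i) Bool.≟ lookup I i))

-- The fixed vertex set and the map that merges vertices

-- The terminals come first, then one vertex for each set of subsets of [n],
-- then the sink. Terminals and sink keep vertices of their own, so that labels
-- need not be distinct from theirs.
order : ℕ → ℕ
order n = n ℕ.+ (2 ^ (2 ^ n) ℕ.+ 1)

n<order : ∀ n → n ℕ.< order n
n<order n = ℕ.m<m+n n (ℕ.m≤n+m 1 (2 ^ (2 ^ n)))

sink : ∀ n → Fin (order n)
sink n = n ↑ʳ ((2 ^ (2 ^ n)) ↑ʳ zero)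

toℕ-sink : ∀ n → toℕ (sink n) ≡ order n ∸ 1
toℕ-sink n = begin
  toℕ (sink n)       ≡⟨ Fin.toℕ-↑ʳ n _ ⟩
  n ℕ.+ toℕ (L ↑ʳ zero {0}) ≡⟨ ≡.cong (n ℕ.+_) (Fin.toℕ-↑ʳ L zero) ⟩
  n ℕ.+ (L ℕ.+ 0)    ≡⟨ ≡.cong (n ℕ.+_) (ℕ.+-identityʳ L) ⟩
  n ℕ.+ L            ≡⟨ ≡.cong (n ℕ.+_) (ℕ.m+n∸n≡m L 1) ⟨
  n ℕ.+ (L ℕ.+ 1 ∸ 1) ≡⟨ ℕ.+-∸-assoc n (ℕ.m≤n+m 1 L) ⟨
  order n ∸ 1        ∎
  where
  open ≡.≡-Reasoning
  L = 2 ^ (2 ^ n)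

canonical-cut : Subset n → Subset (order n)
canonical-cut I = I Vec.++ tabulate (_contains I) Vec.++ outside ∷ []

inject≤≡↑ˡ : ∀ {m} (i : Fin n) .(n≤n+m : n ℕ.≤ n ℕ.+ m) → inject≤ i n≤n+m ≡ i ↑ˡ m
inject≤≡↑ˡ {m = m} i n≤n+m = Fin.toℕ-injective
  (≡.trans (Fin.toℕ-inject≤ i n≤n+m) (≡.sym (Fin.toℕ-↑ˡ i m)))

canonical-cut-terminal : (I : Subset n) → ∀ i → lookup (canonical-cut I) (i ↑ˡ _) ≡ lookup I i
canonical-cut-terminal I i = Vec.lookup-++ˡ I _ i

canonical-cut-label : (I : Subset n) (l : Label n) →
                      lookup (canonical-cut I) (n ↑ʳ (l ↑ˡ 1)) ≡ l contains I
canonical-cut-label I l = ≡.trans (Vec.lookup-++ʳ I _ (l ↑ˡ 1))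
  (≡.trans (Vec.lookup-++ˡ (tabulate (_contains I)) _ l) (Vec.lookup∘tabulate (_contains I) l))

canonical-cut-sink : (I : Subset n) → lookup (canonical-cut I) (sink n) ≡ outside
canonical-cut-sink {n} I = ≡.trans (Vec.lookup-++ʳ I _ ((2 ^ (2 ^ n)) ↑ʳ zero))
  (Vec.lookup-++ʳ (tabulate (_contains I)) (outside ∷ []) zero)

canonical-cut-separates : (I : Subset n) → Separates (n<order n) I (canonical-cut I)
canonical-cut-separates {n} I = separates⁺ (n<order n)
  (λ v eq → ≡.trans (≡.cong (lookup (canonical-cut I)) (Fin.toℕ-injective (≡.trans eq (≡.sym (toℕ-sink n)))))
                    (canonical-cut-sink I))
  (λ i → ≡.trans (≡.cong (lookup (canonical-cut I)) (inject≤≡↑ˡ i _)) (canonical-cut-terminal I i))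

-- A choice of cuts W sends a vertex v to the label {I | v ∈ W I}, so that each
-- W I is the preimage of the canonical cut of I.
module Collapse {n N : ℕ} (n<N : n ℕ.< N) (W : Subset n → Subset N) where

  private
    -- The two decisions are arguments, so that each fact about `collapse` can be proved by matching
    -- on them in a local `go`.
    place : ∀ v → Dec (toℕ v ℕ.< n) → Dec (IsSink n<N v) → Fin (order n)
    place v (yes v<n) _       = fromℕ< v<n ↑ˡ _
    place v (no _)    (yes _) = sink n
    place v (no _)    (no _)  = n ↑ʳ (label (λ I → lookup (W I) v) ↑ˡ 1)

  collapse : Fin N → Fin (order n)
  collapse v = place v (toℕ v ℕ.<? n) (toℕ v ℕ.≟ N ∸ 1)

  collapse-terminal : ∀ i → collapse (inject≤ i (ℕ.<⇒≤ n<N)) ≡ i ↑ˡ _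
  collapse-terminal i = go (toℕ v ℕ.<? n) (toℕ v ℕ.≟ N ∸ 1)
    where
    v = inject≤ i (ℕ.<⇒≤ n<N)
    go : ∀ d d′ → place v d d′ ≡ i ↑ˡ _
    go (yes v<n) _ = ≡.cong (_↑ˡ _) (Fin.toℕ-injective
      (≡.trans (Fin.toℕ-fromℕ< v<n) (Fin.toℕ-inject≤ i (ℕ.<⇒≤ n<N))))
    go (no v≮n)  _ = contradiction (≡.subst (ℕ._< n) (≡.sym (Fin.toℕ-inject≤ i (ℕ.<⇒≤ n<N))) (Fin.toℕ<n i)) v≮n

  collapse-sink : ∀ v → IsSink n<N v → collapse v ≡ sink n
  collapse-sink v eq = go (toℕ v ℕ.<? n) (toℕ v ℕ.≟ N ∸ 1)
    where
    go : ∀ d d′ → place v d d′ ≡ sink n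
    -- From n < N follows n ≤ `N ∸ 1`, so the sink is no terminal.
    go (yes v<n) _         = contradiction (ℕ.<-≤-trans v<n (ℕ.≤-trans (ℕ.<⇒≤pred n<N)
      (ℕ.≤-reflexive (≡.sym eq)))) (ℕ.<-irrefl ≡.refl)
    go (no _)    (yes _)   = ≡.refl
    go (no _)    (no ≢s)   = contradiction eq ≢s

  -- At terminals and at the sink, `Separates` forces the bits of `W I`; at every other vertex the
  -- label records them by construction.
  preimage-canonical-cut : ∀ {I} → Separates n<N I (W I) →
                           ∀ v → lookup (canonical-cut I) (collapse v) ≡ lookup (W I) v
  preimage-canonical-cut {I} sep v = go (toℕ v ℕ.<? n) (toℕ v ℕ.≟ N ∸ 1)
    where
    go : ∀ d d′ → lookup (canonical-cut I) (place v d d′) ≡ lookup (W I) v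
    go (yes v<n) _ = ≡.trans (canonical-cut-terminal I _)
      (≡.trans (≡.sym (separates⁻-terminal n<N sep _))
               (≡.cong (lookup (W I)) (Fin.toℕ-injective
                 (≡.trans (Fin.toℕ-inject≤ (fromℕ< v<n) (ℕ.<⇒≤ n<N)) (Fin.toℕ-fromℕ< v<n)))))
    go (no _) (yes eq) = ≡.trans (canonical-cut-sink I) (≡.sym (separates⁻-sink n<N sep v eq))
    go (no _) (no _)   = ≡.trans (canonical-cut-label I _) (label-contains (λ I → lookup (W I) v) I)

  preimage : Subset (order n) → Subset N
  preimage U = tabulate (lookup U ∘ collapse)

  -- Merging respects terminals and sink, so each admissible cut afterwards comes from an admissible
  -- cut before: no cheaper cut can appear.
  preimage-separates : ∀ {I U} → Separates (n<order n) I U → Separates n<N I (preimage U)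
  preimage-separates {I} {U} sep = separates⁺ n<N
    (λ v eq → ≡.trans (Vec.lookup∘tabulate _ v) (≡.trans (≡.cong (lookup U) (collapse-sink v eq))
      (separates⁻-sink (n<order n) sep (sink n) (toℕ-sink n))))
    (λ i → ≡.trans (Vec.lookup∘tabulate _ (inject≤ i (ℕ.<⇒≤ n<N))) (≡.trans
      (≡.cong (lookup U) (≡.trans (collapse-terminal i) (≡.sym (inject≤≡↑ˡ i _))))
      (separates⁻-terminal (n<order n) sep i)))

module CutCone {c ℓ₁ ℓ₂} (ℝ : OrderedField c ℓ₁ ℓ₂) where
  open OrderedField ℝ renaming (_≤_ to _≼_) hiding (zero)
  open MinCuts ℝ
  open IsDecTotalOrder isDecTotalOrder using (antisym; total; ≤-resp-≈; _≟_)
    renaming (refl to ≼-refl; reflexive to ≼-reflexive; trans to ≼-trans; _≤?_ to _≼?_)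
  open RingProperties ring using (-‿distribˡ-*; -‿distribʳ-*; -0#≈0#; -‿involutive)
  open CommutativeSemigroupProperties +-commutativeSemigroup using () renaming (interchange to +-interchange)
  open CommutativeSemigroupProperties *-commutativeSemigroup using () renaming (x∙yz≈y∙xz to x*yz≈y*xz)
  open SemiringSum semiring
    using (sum; sum-cong-≋; sum-replicate-zero; sum-remove; ∑-distrib-+; ∑-comm; *-distribˡ-sum; *-distribʳ-sum)
  open SetoidReasoning setoid

  private
    variable
      p q : Level
      P : Set p

  -- Arithmetic in an ordered field

  ≼-respˡ-≈ : ∀ {x y z} → x ≈ y → x ≼ z → y ≼ z
  ≼-respˡ-≈ x≈y = proj₂ ≤-resp-≈ x≈y

  ≼-respʳ-≈ : ∀ {x y z} → x ≈ y → z ≼ x → z ≼ y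
  ≼-respʳ-≈ x≈y = proj₁ ≤-resp-≈ x≈y

  nonNeg-+ : ∀ {x y} → 0# ≼ x → 0# ≼ y → 0# ≼ x + y
  nonNeg-+ {x} {y} 0≼x 0≼y = ≼-trans 0≼y (≼-respˡ-≈ (+-identityˡ y) (+-monoˡ-≤ y 0≼x))

  nonNeg-sum : (f : Fin k → Carrier) → (∀ i → 0# ≼ f i) → 0# ≼ sum f
  nonNeg-sum {zero}  f 0≼f = ≼-refl
  nonNeg-sum {suc k} f 0≼f = nonNeg-+ (0≼f zero) (nonNeg-sum (f ∘ suc) (0≼f ∘ suc))

  ≼⇒nonNeg-difference : ∀ {x y} → x ≼ y → 0# ≼ y + - x
  ≼⇒nonNeg-difference {x} x≼y = ≼-respˡ-≈ (-‿inverseʳ x) (+-monoˡ-≤ (- x) x≼y)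

  x-y+y≈x : ∀ x y → (x + - y) + y ≈ x
  x-y+y≈x x y = trans (+-assoc x (- y) y) (trans (+-congˡ (-‿inverseˡ y)) (+-identityʳ x))

  nonNeg-difference⇒≼ : ∀ {x y} → 0# ≼ y + - x → x ≼ y
  nonNeg-difference⇒≼ {x} {y} 0≼y-x =
    ≼-respʳ-≈ (x-y+y≈x y x) (≼-respˡ-≈ (+-identityˡ x) (+-monoˡ-≤ x 0≼y-x))

  nonPos⇒nonNeg-neg : ∀ {x} → x ≼ 0# → 0# ≼ - x
  nonPos⇒nonNeg-neg {x} x≼0 = ≼-respʳ-≈ (+-identityˡ (- x)) (≼⇒nonNeg-difference x≼0)

  nonNeg-neg⇒nonPos : ∀ {x} → 0# ≼ - x → x ≼ 0#
  nonNeg-neg⇒nonPos {x} 0≼-x = nonNeg-difference⇒≼ (≼-respʳ-≈ (sym (+-identityˡ (- x))) 0≼-x)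

  ≰0⇒0≼ : ∀ {x} → ¬ (x ≼ 0#) → 0# ≼ x
  ≰0⇒0≼ {x} x≰0 with total x 0#
  ... | inj₁ x≼0 = contradiction x≼0 x≰0
  ... | inj₂ 0≼x = 0≼x

  0≼1 : 0# ≼ 1#
  0≼1 with total 1# 0#
  ... | inj₂ 0≼1 = 0≼1
  ... | inj₁ 1≼0 = ≼-respʳ-≈ -1*-1≈1 (*-nonNeg 0≼-1 0≼-1)
    where
    0≼-1 = nonPos⇒nonNeg-neg 1≼0
    -1*-1≈1 : - 1# * - 1# ≈ 1#
    -1*-1≈1 = begin
      - 1# * - 1#    ≈⟨ -‿distribˡ-* 1# (- 1#) ⟨
      - (1# * - 1#)  ≈⟨ -‿cong (*-identityˡ (- 1#)) ⟩
      - (- 1#)       ≈⟨ -‿involutive 1# ⟩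
      1#             ∎

  -- Strict positivity in the form in which `_≼?_` delivers it.
  module _ {x : Carrier} (x≰0 : ¬ (x ≼ 0#)) where

    pos≉0 : ¬ (x ≈ 0#)
    pos≉0 x≈0 = x≰0 (≼-reflexive x≈0)

    -- If y ≤ 0, the product is squeezed to 0, and the inverse of x turns this into y = 0.
    pos-*-cancel-nonNeg : ∀ {y} → 0# ≼ x * y → 0# ≼ y
    pos-*-cancel-nonNeg {y} 0≼xy with total 0# y
    ... | inj₁ 0≼y = 0≼y
    ... | inj₂ y≼0 = ≼-reflexive (sym y≈0)
      where
      xy≼0 : x * y ≼ 0#
      xy≼0 = nonNeg-neg⇒nonPos (≼-respʳ-≈ (sym (-‿distribʳ-* x y))
        (*-nonNeg (≰0⇒0≼ x≰0) (nonPos⇒nonNeg-neg y≼0)))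
      x⁻¹ = proj₁ (inverse x pos≉0)
      y≈0 : y ≈ 0#
      y≈0 = begin
        y              ≈⟨ *-identityˡ y ⟨
        1# * y         ≈⟨ *-congʳ (trans (*-comm x⁻¹ x) (proj₂ (inverse x pos≉0))) ⟨
        (x⁻¹ * x) * y  ≈⟨ *-assoc x⁻¹ x y ⟩
        x⁻¹ * (x * y)  ≈⟨ *-congˡ (antisym xy≼0 0≼xy) ⟩
        x⁻¹ * 0#       ≈⟨ zeroʳ x⁻¹ ⟩
        0#             ∎

    root : ∀ y → ∃[ t ] x * t + y ≈ 0#
    root y = - (x⁻¹ * y) , (begin
      x * - (x⁻¹ * y) + y    ≈⟨ +-congʳ (-‿distribʳ-* x (x⁻¹ * y)) ⟨
      - (x * (x⁻¹ * y)) + y  ≈⟨ +-congʳ (-‿cong (*-assoc x x⁻¹ y)) ⟨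
      - ((x * x⁻¹) * y) + y  ≈⟨ +-congʳ (-‿cong (*-congʳ (proj₂ (inverse x pos≉0)))) ⟩
      - (1# * y) + y         ≈⟨ +-congʳ (-‿cong (*-identityˡ y)) ⟩
      - y + y                ≈⟨ -‿inverseˡ y ⟩
      0#                     ∎)
      where x⁻¹ = proj₁ (inverse x pos≉0)

  module _ {c ℓ t s : Carrier} (c≰0 : ¬ (c ≼ 0#)) where

    ≼-affine⇒≼ : c * s + ℓ ≼ c * t + ℓ → s ≼ t
    ≼-affine⇒≼ h = nonNeg-difference⇒≼ (pos-*-cancel-nonNeg c≰0 (≼-respʳ-≈ eq (≼⇒nonNeg-difference h)))
      where
      eq : (c * t + ℓ) + - (c * s + ℓ) ≈ c * (t + - s)
      eq = begin
        (c * t + ℓ) + - (c * s + ℓ)      ≈⟨ +-congˡ (AbelianGroupProperties.⁻¹-∙-comm +-abelianGroup (c * s) ℓ) ⟨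
        (c * t + ℓ) + (- (c * s) + - ℓ)  ≈⟨ +-interchange (c * t) ℓ (- (c * s)) (- ℓ) ⟩
        (c * t + - (c * s)) + (ℓ + - ℓ)  ≈⟨ +-cong (+-congˡ (-‿distribʳ-* c s)) (-‿inverseʳ ℓ) ⟩
        (c * t + c * - s) + 0#           ≈⟨ +-identityʳ _ ⟩
        c * t + c * - s                  ≈⟨ distribˡ c t (- s) ⟨
        c * (t + - s)                    ∎

  affine-mono : ∀ {c ℓ s t} → 0# ≼ c → s ≼ t → 0# ≼ c * s + ℓ → 0# ≼ c * t + ℓ
  affine-mono {c} {ℓ} {s} {t} 0≼c s≼t h =
    ≼-respʳ-≈ eq (nonNeg-+ (*-nonNeg 0≼c (≼⇒nonNeg-difference s≼t)) h)
    where
    eq : c * (t + - s) + (c * s + ℓ) ≈ c * t + ℓ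
    eq = begin
      c * (t + - s) + (c * s + ℓ)    ≈⟨ +-assoc _ _ _ ⟨
      (c * (t + - s) + c * s) + ℓ    ≈⟨ +-congʳ (distribˡ c (t + - s) s) ⟨
      c * ((t + - s) + s) + ℓ        ≈⟨ +-congʳ (*-congˡ (x-y+y≈x t s)) ⟩
      c * t + ℓ                      ∎

  -- The multipliers cancel t. For a > 0 > b both are positive, so this combination of two
  -- constraints is a consequence of them.
  cross-elimination : ∀ a b x y t → a * (b * t + y) + - b * (a * t + x) ≈ a * y + - b * x
  cross-elimination a b x y t = begin
    a * (b * t + y) + - b * (a * t + x)                  ≈⟨ +-cong (distribˡ a _ _) (distribˡ (- b) _ _) ⟩
    (a * (b * t) + a * y) + (- b * (a * t) + - b * x)    ≈⟨ +-interchange _ _ _ _ ⟩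
    (a * (b * t) + - b * (a * t)) + (a * y + - b * x)    ≈⟨ +-congʳ eq ⟩
    0# + (a * y + - b * x)                               ≈⟨ +-identityˡ _ ⟩
    a * y + - b * x                                      ∎
    where
    eq : a * (b * t) + - b * (a * t) ≈ 0#
    eq = begin
      a * (b * t) + - b * (a * t)    ≈⟨ +-cong (x*yz≈y*xz a b t) (sym (-‿distribˡ-* b (a * t))) ⟩
      b * (a * t) + - (b * (a * t))  ≈⟨ -‿inverseʳ _ ⟩
      0#                             ∎

  -- Fourier–Motzkin elimination

  module _ {k} (c ℓ : Fin k → Carrier) where

    Feasible : Carrier → Set ℓ₂
    Feasible t = ∀ i → 0# ≼ c i * t + ℓ i

    -- A positive slope bounds t from below, a negative one from above. The second clause says that
    -- each lower bound is at most each upper bound, with denominators cleared. The first treats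
    -- zero slopes, with c = 0 written as two inequalities.
    Eliminated : Set ℓ₂
    Eliminated = (∀ i → c i ≼ 0# → 0# ≼ c i → 0# ≼ ℓ i) ×
                 (∀ i j → ¬ (c i ≼ 0#) → ¬ (0# ≼ c j) → 0# ≼ c i * ℓ j + - c j * ℓ i)

  vanishing-slope : ∀ {c ℓ t} → c ≼ 0# → 0# ≼ c → c * t + ℓ ≈ ℓ
  vanishing-slope {c} {ℓ} {t} c≼0 0≼c =
    trans (+-congʳ (trans (*-congʳ (antisym c≼0 0≼c)) (zeroˡ t))) (+-identityˡ ℓ)

  ≱0⇒0≼- : ∀ {x} → ¬ (0# ≼ x) → 0# ≼ - x
  ≱0⇒0≼- {x} 0⋠x with total 0# x
  ... | inj₁ 0≼x = contradiction 0≼x 0⋠x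
  ... | inj₂ x≼0 = nonPos⇒nonNeg-neg x≼0

  feasible⇒eliminated : (c ℓ : Fin k → Carrier) → ∃ (Feasible c ℓ) → Eliminated c ℓ
  feasible⇒eliminated c ℓ (t , h) =
    (λ i c≼0 0≼c → ≼-respʳ-≈ (vanishing-slope c≼0 0≼c) (h i)) ,
    (λ i j ci≰0 cj≱0 → ≼-respʳ-≈ (cross-elimination (c i) (c j) (ℓ i) (ℓ j) t)
      (nonNeg-+ (*-nonNeg (≰0⇒0≼ ci≰0) (h j)) (*-nonNeg (≱0⇒0≼- cj≱0) (h i))))

  -- By induction, t is the largest root among the constraints of positive slope. A new constraint
  -- either holds at the old t, or its root lies further right and `affine-mono` carries the earlier
  -- constraints there.
  greatest-lower-constraint : (c ℓ : Fin k → Carrier) → (∀ i → c i ≼ 0#) ⊎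
    ∃[ t ] ∃[ i ] ¬ (c i ≼ 0#) × c i * t + ℓ i ≈ 0# × (∀ j → ¬ (c j ≼ 0#) → 0# ≼ c j * t + ℓ j)
  greatest-lower-constraint {zero}  c ℓ = inj₁ λ ()
  greatest-lower-constraint {suc k} c ℓ
    with c zero ≼? 0# | greatest-lower-constraint (c ∘ suc) (ℓ ∘ suc)
  ... | yes c≼0 | inj₁ none = inj₁ λ { zero → c≼0 ; (suc i) → none i }
  ... | yes c≼0 | inj₂ (t , i , pos , tight , h) =
    inj₂ (t , suc i , pos , tight , λ { zero c≰0 → contradiction c≼0 c≰0 ; (suc j) → h j })
  ... | no c≰0 | inj₁ none = inj₂ (r , zero , c≰0 , r-root ,
      λ { zero _ → ≼-reflexive (sym r-root) ; (suc j) c≰0 → contradiction (none j) c≰0 })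
    where
    r = proj₁ (root c≰0 (ℓ zero))
    r-root = proj₂ (root c≰0 (ℓ zero))
  ... | no c≰0 | inj₂ (t , i , pos , tight , h) with total 0# (c zero * t + ℓ zero)
  ...   | inj₁ 0≼ = inj₂ (t , suc i , pos , tight , λ { zero _ → 0≼ ; (suc j) → h j })
  ...   | inj₂ ≼0 = inj₂ (r , zero , c≰0 , r-root ,
      λ { zero _ → ≼-reflexive (sym r-root)
        ; (suc j) cj≰0 → affine-mono (≰0⇒0≼ cj≰0) t≼r (h j cj≰0) })
    where
    r = proj₁ (root c≰0 (ℓ zero))
    r-root = proj₂ (root c≰0 (ℓ zero))
    t≼r : t ≼ r
    t≼r = ≼-affine⇒≼ c≰0 (≼-respʳ-≈ (sym r-root) ≼0)

  eliminated⇒feasible : (c ℓ : Fin k → Carrier) → Eliminated c ℓ → ∃ (Feasible c ℓ)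
  eliminated⇒feasible c ℓ (zeros , pairs) with greatest-lower-constraint c ℓ
  ... | inj₂ (t , i , ci≰0 , tight , h) = t , feasible
    where
    feasible : Feasible c ℓ t
    feasible j with c j ≼? 0# | 0# ≼? c j
    ... | no cj≰0  | _        = h j cj≰0
    ... | yes cj≼0 | yes 0≼cj = ≼-respʳ-≈ (sym (vanishing-slope cj≼0 0≼cj)) (zeros j cj≼0 0≼cj)
    -- Constraint i is tight at t, so its combination with constraint j reduces to `c i` times
    -- constraint j, and `c i` is positive.
    ... | yes _    | no 0⋠cj  = pos-*-cancel-nonNeg ci≰0 (≼-respʳ-≈ eq (pairs i j ci≰0 0⋠cj))
      where
      eq : c i * ℓ j + - c j * ℓ i ≈ c i * (c j * t + ℓ j)
      eq = begin
        c i * ℓ j + - c j * ℓ i                            ≈⟨ cross-elimination (c i) (c j) (ℓ i) (ℓ j) t ⟨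
        c i * (c j * t + ℓ j) + - c j * (c i * t + ℓ i)    ≈⟨ +-congˡ (trans (*-congˡ tight) (zeroʳ (- c j))) ⟩
        c i * (c j * t + ℓ j) + 0#                         ≈⟨ +-identityʳ _ ⟩
        c i * (c j * t + ℓ j)                              ∎
  -- Without lower bounds, the reflection of t to -t turns upper bounds into lower ones.
  ... | inj₁ c≼0 with greatest-lower-constraint (-_ ∘ c) ℓ
  -- All slopes vanish here, so any t would do.
  ...   | inj₁ -c≼0 = 0# , λ i →
    let 0≼ci = ≼-respʳ-≈ (-‿involutive (c i)) (nonPos⇒nonNeg-neg (-c≼0 i)) in
    ≼-respʳ-≈ (sym (vanishing-slope (c≼0 i) 0≼ci)) (zeros i (c≼0 i) 0≼ci)
  ...   | inj₂ (t , _ , _ , _ , h) = - t , feasible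
    where
    feasible : Feasible c ℓ (- t)
    feasible j with 0# ≼? c j
    ... | yes 0≼cj = ≼-respʳ-≈ (sym (vanishing-slope (c≼0 j) 0≼cj)) (zeros j (c≼0 j) 0≼cj)
    ... | no 0⋠cj = ≼-respʳ-≈ (+-congʳ (trans (sym (-‿distribˡ-* (c j) t)) (-‿distribʳ-* (c j) t)))
      (h j (λ -cj≼0 → 0⋠cj (≼-respʳ-≈ (-‿involutive (c j)) (nonPos⇒nonNeg-neg -cj≼0))))

  -- Finite sums and the pairing of coordinate vectors

  when-cong : (d : Dec P) {f g : .P → Carrier} → (∀ .a → f a ≈ g a) → f when d ≈ g when d
  when-cong (yes a) f≈g = f≈g a
  when-cong (no _)  f≈g = refl

  when-+ : (d : Dec P) (f g : .P → Carrier) → (λ a → f a + g a) when d ≈ f when d + g when d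
  when-+ (yes a) f g = refl
  when-+ (no _)  f g = sym (+-identityˡ 0#)

  when-*ˡ : (d : Dec P) (t : Carrier) (f : .P → Carrier) → (λ a → t * f a) when d ≈ t * (f when d)
  when-*ˡ (yes a) t f = refl
  when-*ˡ (no _)  t f = sym (zeroʳ t)

  when-nonNeg : (d : Dec P) (f : .P → Carrier) → (∀ .a → 0# ≼ f a) → 0# ≼ f when d
  when-nonNeg (yes a) f 0≼f = 0≼f a
  when-nonNeg (no _)  f 0≼f = ≼-refl

  ∑-subsets-cong : ∀ n {f g : Subset n → Carrier} → (∀ I → f I ≈ g I) → ∑-subsets n f ≈ ∑-subsets n g
  ∑-subsets-cong zero    f≈g = f≈g []
  ∑-subsets-cong (suc n) f≈g =
    +-cong (∑-subsets-cong n (f≈g ∘ (outside ∷_))) (∑-subsets-cong n (f≈g ∘ (inside ∷_)))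

  ∑-subsets-+ : ∀ n (f g : Subset n → Carrier) →
                ∑-subsets n (λ I → f I + g I) ≈ ∑-subsets n f + ∑-subsets n g
  ∑-subsets-+ zero    f g = refl
  ∑-subsets-+ (suc n) f g = trans
    (+-cong (∑-subsets-+ n (f ∘ (outside ∷_)) (g ∘ (outside ∷_)))
            (∑-subsets-+ n (f ∘ (inside ∷_)) (g ∘ (inside ∷_))))
    (+-interchange _ _ _ _)

  ∑-subsets-*ˡ : ∀ n t (f : Subset n → Carrier) → ∑-subsets n (λ I → t * f I) ≈ t * ∑-subsets n f
  ∑-subsets-*ˡ zero    t f = refl
  ∑-subsets-*ˡ (suc n) t f = trans
    (+-cong (∑-subsets-*ˡ n t (f ∘ (outside ∷_))) (∑-subsets-*ˡ n t (f ∘ (inside ∷_))))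
    (sym (distribˡ t _ _))

  ∑-subsets-zero : ∀ n {f : Subset n → Carrier} → (∀ I → f I ≈ 0#) → ∑-subsets n f ≈ 0#
  ∑-subsets-zero zero    f≈0 = f≈0 []
  ∑-subsets-zero (suc n) f≈0 = trans
    (+-cong (∑-subsets-zero n (f≈0 ∘ (outside ∷_))) (∑-subsets-zero n (f≈0 ∘ (inside ∷_))))
    (+-identityˡ 0#)

  ∑-subsets-concentrated : (f : Subset n → Carrier) (J : Subset n) →
                           (∀ I → J ≢ I → f I ≈ 0#) → ∑-subsets n f ≈ f J
  ∑-subsets-concentrated f []            f≈0 = refl
  ∑-subsets-concentrated f (outside ∷ J) f≈0 = trans
    (+-cong (∑-subsets-concentrated (f ∘ (outside ∷_)) J (λ I J≢I → f≈0 (outside ∷ I) (J≢I ∘ Vec.∷-injectiveʳ)))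
            (∑-subsets-zero _ (λ I → f≈0 (inside ∷ I) λ ())))
    (+-identityʳ _)
  ∑-subsets-concentrated f (inside ∷ J)  f≈0 = trans
    (+-cong (∑-subsets-zero _ (λ I → f≈0 (outside ∷ I) λ ()))
            (∑-subsets-concentrated (f ∘ (inside ∷_)) J (λ I J≢I → f≈0 (inside ∷ I) (J≢I ∘ Vec.∷-injectiveʳ))))
    (+-identityˡ _)

  sum-concentrated : (f : Fin k → Carrier) (i : Fin k) → (∀ j → i ≢ j → f j ≈ 0#) → sum f ≈ f i
  sum-concentrated {suc k} f i f≈0 = begin
    sum f                             ≈⟨ sum-remove f ⟩
    f i + sum (Vector.removeAt f i)   ≈⟨ +-congˡ (sum-cong-≋ (λ j → f≈0 (punchIn i j) (Fin.punchInᵢ≢i i j ∘ ≡.sym))) ⟩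
    f i + sum (λ (_ : Fin k) → 0#)    ≈⟨ +-congˡ (sum-replicate-zero k) ⟩
    f i + 0#                          ≈⟨ +-identityʳ (f i) ⟩
    f i                               ∎

  ⟪⟫-cong : {a x y : ℝ^ n} → (∀ I → x I ≈ y I) → ⟪ a , x ⟫ ≈ ⟪ a , y ⟫
  ⟪⟫-cong {n} x≈y = ∑-subsets-cong n λ I → when-cong (nonempty? I) λ I≢∅ → *-congˡ (x≈y (I , [ I≢∅ ]))

  ⟪⟫-comm : (a x : ℝ^ n) → ⟪ a , x ⟫ ≈ ⟪ x , a ⟫
  ⟪⟫-comm {n} a x = ∑-subsets-cong n λ I → when-cong (nonempty? I) λ I≢∅ → *-comm _ _

  ⟪⟫-+ʳ : (a x y : ℝ^ n) → ⟪ a , (λ I → x I + y I) ⟫ ≈ ⟪ a , x ⟫ + ⟪ a , y ⟫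
  ⟪⟫-+ʳ {n} a x y = trans
    (∑-subsets-cong n λ I → trans
      (when-cong (nonempty? I) λ I≢∅ → distribˡ _ _ _)
      (when-+ (nonempty? I) (λ I≢∅ → a (I , [ I≢∅ ]) * x (I , [ I≢∅ ])) (λ I≢∅ → a (I , [ I≢∅ ]) * y (I , [ I≢∅ ]))))
    (∑-subsets-+ n _ _)

  ⟪⟫-*ʳ : ∀ t (a x : ℝ^ n) → ⟪ a , (λ I → t * x I) ⟫ ≈ t * ⟪ a , x ⟫
  ⟪⟫-*ʳ {n} t a x = trans
    (∑-subsets-cong n λ I → trans
      (when-cong (nonempty? I) λ I≢∅ → x*yz≈y*xz _ _ _)
      (when-*ˡ (nonempty? I) t (λ I≢∅ → a (I , [ I≢∅ ]) * x (I , [ I≢∅ ]))))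
    (∑-subsets-*ˡ n t _)

  ⟪⟫-0ʳ : (a : ℝ^ n) → ⟪ a , (λ _ → 0#) ⟫ ≈ 0#
  ⟪⟫-0ʳ a = trans (⟪⟫-cong {a = a} (λ _ → sym (zeroˡ 0#))) (trans (⟪⟫-*ʳ 0# a (λ _ → 0#)) (zeroˡ _))

  ⟪⟫-sumʳ : (a : ℝ^ n) (y : Fin k → ℝ^ n) → ⟪ a , (λ I → sum λ i → y i I) ⟫ ≈ sum λ i → ⟪ a , y i ⟫
  ⟪⟫-sumʳ {k = zero}  a y = ⟪⟫-0ʳ a
  ⟪⟫-sumʳ {k = suc k} a y = trans
    (⟪⟫-+ʳ a (y zero) (λ I → sum λ i → y (suc i) I)) (+-congˡ (⟪⟫-sumʳ a (y ∘ suc)))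

  unit : NonemptySubset n → ℝ^ n
  unit J I = (λ _ → 1#) when (Vec.≡-dec Bool._≟_ (value J) (value I))

  ⟪unit⟫ : (J : NonemptySubset n) (x : ℝ^ n) → ⟪ unit J , x ⟫ ≈ x J
  ⟪unit⟫ {n} (J , [ J≢∅ ]) x = trans (∑-subsets-concentrated _ J off) on
    where
    off : ∀ I → J ≢ I → (λ I≢∅ → unit (J , [ J≢∅ ]) (I , [ I≢∅ ]) * x (I , [ I≢∅ ])) when nonempty? I ≈ 0#
    off I J≢I with nonempty? I
    ... | no _ = refl
    ... | yes _ with Vec.≡-dec Bool._≟_ J I
    ...   | yes J≡I = contradiction J≡I J≢I
    ...   | no _    = zeroˡ _
    on : (λ I≢∅ → unit (J , [ J≢∅ ]) (J , [ I≢∅ ]) * x (J , [ I≢∅ ])) when nonempty? J ≈ x (J , [ J≢∅ ])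
    on with nonempty? J
    ... | no J≡∅ = contradiction-irr J≢∅ J≡∅
    ... | yes _ with Vec.≡-dec Bool._≟_ J J
    ...   | yes _  = *-identityˡ _
    ...   | no J≢J = contradiction ≡.refl J≢J

  -- Linear forms and finite systems of homogeneous inequalities

  -- A form on ℝᵏ × ℝ^ n: the first k variables are those to be eliminated.
  Form : ℕ → ℕ → Set c
  Form k n = (Fin k → Carrier) × ℝ^ n

  eval : Form k n → (Fin k → Carrier) → ℝ^ n → Carrier
  eval (b , a) v x = (sum λ i → b i * v i) + ⟪ a , x ⟫

  -- Coefficients are part of the data, so the closure lemmas compute them from the shape of an
  -- expression.
  Linear : ((Fin k → Carrier) → ℝ^ n → Carrier) → Set (c ⊔ ℓ₁)
  Linear {k} {n} f = Σ[ a ∈ Form k n ] (∀ v x → f v x ≈ eval a v x)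

  linear-eval : (a : Form k n) → Linear (eval a)
  linear-eval a = a , λ _ _ → refl

  linear-variable : (i : Fin k) → Linear {k} {n} (λ v x → v i)
  linear-variable {k} {n} i = (δ , λ _ → 0#) , λ v x → sym (begin
    (sum λ j → δ j * v j) + ⟪ (λ _ → 0#) , x ⟫  ≈⟨ +-cong (sum-concentrated _ i (off v)) (trans (⟪⟫-comm (λ _ → 0#) x) (⟪⟫-0ʳ x)) ⟩
    δ i * v i + 0#                              ≈⟨ +-identityʳ _ ⟩
    δ i * v i                                   ≈⟨ on v ⟩
    v i                                         ∎)
    where
    δ : Fin k → Carrier
    δ j = (λ _ → 1#) when (i Fin.≟ j)
    off : ∀ (v : Fin k → Carrier) j → i ≢ j → δ j * v j ≈ 0#
    off v j i≢j with i Fin.≟ j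
    ... | yes i≡j = contradiction i≡j i≢j
    ... | no _    = zeroˡ _
    on : ∀ (v : Fin k → Carrier) → δ i * v i ≈ v i
    on v with i Fin.≟ i
    ... | yes _  = *-identityˡ _
    ... | no i≢i = contradiction ≡.refl i≢i

  linear-coordinate : (I : NonemptySubset n) → Linear {k} {n} (λ v x → x I)
  linear-coordinate {n} {k} I = ((λ _ → 0#) , unit I) , λ v x → sym (begin
    (sum λ j → 0# * v j) + ⟪ unit I , x ⟫  ≈⟨ +-cong (trans (sum-cong-≋ (λ j → zeroˡ (v j))) (sum-replicate-zero k)) (⟪unit⟫ I x) ⟩
    0# + x I                               ≈⟨ +-identityˡ _ ⟩
    x I                                    ∎)

  linear-+ : {f g : (Fin k → Carrier) → ℝ^ n → Carrier} → Linear f → Linear g → Linear (λ v x → f v x + g v x)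
  linear-+ {f = f} {g} ((b , a) , f≈) ((b′ , a′) , g≈) =
    ((λ i → b i + b′ i) , (λ I → a I + a′ I)) , λ v x → begin
      f v x + g v x                      ≈⟨ +-cong (f≈ v x) (g≈ v x) ⟩
      eval (b , a) v x + eval (b′ , a′) v x  ≈⟨ +-interchange _ _ _ _ ⟩
      ((sum λ i → b i * v i) + (sum λ i → b′ i * v i)) + (⟪ a , x ⟫ + ⟪ a′ , x ⟫)
        ≈⟨ +-cong (trans (sum-cong-≋ (λ i → distribʳ (v i) (b i) (b′ i))) (∑-distrib-+ (λ i → b i * v i) (λ i → b′ i * v i))) (⟪⟫-+ˡ x) ⟨
      (sum λ i → (b i + b′ i) * v i) + ⟪ (λ I → a I + a′ I) , x ⟫  ∎
    where
    ⟪⟫-+ˡ : ∀ x → ⟪ (λ I → a I + a′ I) , x ⟫ ≈ ⟪ a , x ⟫ + ⟪ a′ , x ⟫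
    ⟪⟫-+ˡ x = trans (⟪⟫-comm (λ I → a I + a′ I) x) (trans (⟪⟫-+ʳ x a a′) (+-cong (⟪⟫-comm x a) (⟪⟫-comm x a′)))

  linear-*ˡ : ∀ t {f : (Fin k → Carrier) → ℝ^ n → Carrier} → Linear f → Linear (λ v x → t * f v x)
  linear-*ˡ t {f} ((b , a) , f≈) = ((λ i → t * b i) , (λ I → t * a I)) , λ v x → begin
    t * f v x                                        ≈⟨ *-congˡ (f≈ v x) ⟩
    t * eval (b , a) v x                             ≈⟨ distribˡ t _ _ ⟩
    t * (sum λ i → b i * v i) + t * ⟪ a , x ⟫         ≈⟨ +-cong (*-distribˡ-sum t (λ i → b i * v i)) (sym (⟪⟫-*ˡ x)) ⟩
    (sum λ i → t * (b i * v i)) + ⟪ (λ I → t * a I) , x ⟫  ≈⟨ +-congʳ (sum-cong-≋ (λ i → *-assoc t (b i) (v i))) ⟨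
    (sum λ i → (t * b i) * v i) + ⟪ (λ I → t * a I) , x ⟫  ∎
    where
    ⟪⟫-*ˡ : ∀ x → ⟪ (λ I → t * a I) , x ⟫ ≈ t * ⟪ a , x ⟫
    ⟪⟫-*ˡ x = trans (⟪⟫-comm (λ I → t * a I) x) (trans (⟪⟫-*ʳ t x a) (*-congˡ (⟪⟫-comm x a)))

  linear-cong : {f g : (Fin k → Carrier) → ℝ^ n → Carrier} → (∀ v x → g v x ≈ f v x) → Linear f → Linear g
  linear-cong g≈f (a , f≈) = a , λ v x → trans (g≈f v x) (f≈ v x)

  linear-0 : Linear {k} {n} (λ _ _ → 0#)
  linear-0 = linear-cong (λ v x → sym (zeroˡ _)) (linear-*ˡ 0# (linear-eval ((λ _ → 0#) , (λ _ → 0#))))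

  linear-sum : ∀ {m} {f : Fin m → (Fin k → Carrier) → ℝ^ n → Carrier} →
               (∀ i → Linear (f i)) → Linear (λ v x → sum λ i → f i v x)
  linear-sum {m = zero}  f-linear = linear-0
  linear-sum {m = suc m} f-linear = linear-+ (f-linear zero) (linear-sum (f-linear ∘ suc))

  -- For k = 0 this is `Polyhedral` up to an empty sum in each form.
  Definable : ((Fin k → Carrier) → ℝ^ n → Set p) → Set (c ⊔ ℓ₂ ⊔ p)
  Definable {k} {n} P = Σ[ m ∈ ℕ ] Σ[ a ∈ (Fin m → Form k n) ] (∀ v x → P v x ⇔ (∀ i → 0# ≼ eval (a i) v x))

  definable-⇔ : {P : (Fin k → Carrier) → ℝ^ n → Set p} {Q : (Fin k → Carrier) → ℝ^ n → Set q} →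
                (∀ v x → P v x ⇔ Q v x) → Definable P → Definable Q
  definable-⇔ P⇔Q (m , a , iff) = m , a , λ v x →
    mk⇔ (to (iff v x) ∘ from (P⇔Q v x)) (to (P⇔Q v x) ∘ from (iff v x))

  definable-nonNeg : {f : (Fin k → Carrier) → ℝ^ n → Carrier} → Linear f → Definable (λ v x → 0# ≼ f v x)
  definable-nonNeg (a , f≈) = 1 , (λ _ → a) , λ v x →
    mk⇔ (λ 0≼f _ → ≼-respʳ-≈ (f≈ v x) 0≼f) (λ 0≼a → ≼-respʳ-≈ (sym (f≈ v x)) (0≼a zero))

  definable-≼ : {f g : (Fin k → Carrier) → ℝ^ n → Carrier} → Linear f → Linear g → Definable (λ v x → f v x ≼ g v x)
  definable-≼ {f = f} {g} f-linear g-linear = definable-⇔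
    (λ v x → mk⇔ (nonNeg-difference⇒≼ ∘ ≼-respʳ-≈ (+-congˡ (-1*x≈-x (f v x))))
                 (≼-respʳ-≈ (+-congˡ (sym (-1*x≈-x (f v x)))) ∘ ≼⇒nonNeg-difference))
    (definable-nonNeg (linear-+ g-linear (linear-*ˡ (- 1#) f-linear)))
    where open RingProperties ring using (-1*x≈-x)

  definable-× : {P : (Fin k → Carrier) → ℝ^ n → Set p} {Q : (Fin k → Carrier) → ℝ^ n → Set q} →
                Definable P → Definable Q → Definable (λ v x → P v x × Q v x)
  definable-× (m , a , P⇔) (m′ , a′ , Q⇔) = m ℕ.+ m′ , a Vector.++ a′ , λ v x → mk⇔
    (λ (Pvx , Qvx) i → both v x i (to (P⇔ v x) Pvx) (to (Q⇔ v x) Qvx))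
    (λ h → from (P⇔ v x) (λ i → ≡.subst (λ b → 0# ≼ eval b v x) (Vector.lookup-++ˡ a a′ i) (h (i ↑ˡ m′))) ,
           from (Q⇔ v x) (λ i → ≡.subst (λ b → 0# ≼ eval b v x) (Vector.lookup-++ʳ a a′ i) (h (m ↑ʳ i))))
    where
    both : ∀ v x i → (∀ i → 0# ≼ eval (a i) v x) → (∀ i → 0# ≼ eval (a′ i) v x) → 0# ≼ eval ((a Vector.++ a′) i) v x
    both v x i h h′ with splitAt m i
    ... | inj₁ j = h j
    ... | inj₂ j = h′ j

  definable-∀ : ∀ {m} {P : Fin m → (Fin k → Carrier) → ℝ^ n → Set p} →
                (∀ i → Definable (P i)) → Definable (λ v x → ∀ i → P i v x)
  definable-∀ {m = zero}  P-def = 0 , (λ ()) , λ v x → mk⇔ (λ _ ()) (λ _ ())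
  definable-∀ {m = suc m} P-def = definable-⇔
    (λ v x → mk⇔ (uncurry Fin.∀-cons) (λ P∀ → P∀ zero , P∀ ∘ suc))
    (definable-× (P-def zero) (definable-∀ (P-def ∘ suc)))

  -- The guard does not depend on the point (v, x), so deciding it once either keeps the whole
  -- system or leaves the empty one.
  definable-→ : ∀ {a} {A : Set a} {P : (Fin k → Carrier) → ℝ^ n → Set p} → Dec A →
                Definable P → Definable (λ v x → A → P v x)
  definable-→ (yes a) P-def = definable-⇔ (λ v x → mk⇔ const (λ P∀ → P∀ a)) P-def
  definable-→ (no ¬a) P-def = 0 , (λ ()) , λ v x → mk⇔ (λ _ ()) (λ _ a → contradiction a ¬a)

  definable-irrelevant-∀ : ∀ {a} {A : Set a} {P : .A → (Fin k → Carrier) → ℝ^ n → Set p} → Dec A →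
                (∀ .a → Definable (P a)) → Definable (λ v x → ∀ .a → P a v x)
  definable-irrelevant-∀ {P = P} (yes a) P-def = definable-⇔ {Q = λ v x → ∀ .a → P a v x}
    (λ v x → mk⇔ (λ Pa .a → Pa) (λ P∀ → P∀ a)) (P-def a)
  definable-irrelevant-∀ (no ¬a) P-def = 0 , (λ ()) , λ v x → mk⇔ (λ _ ()) (λ _ .a → contradiction-irr a ¬a)

  definable-∀-Subset : ∀ {m} {P : Subset m → (Fin k → Carrier) → ℝ^ n → Set p} →
                       (∀ W → Definable (P W)) → Definable (λ v x → ∀ W → P W v x)
  definable-∀-Subset {P = P} P-def = definable-⇔
    (λ v x → mk⇔ (λ P∀ W → ≡.subst (λ W → P W v x) (decode-encode W) (P∀ (encode W))) (λ P∀ → P∀ ∘ decode))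
    (definable-∀ (P-def ∘ decode))

  definable-∀-NonemptySubset : ∀ {m} {P : NonemptySubset m → (Fin k → Carrier) → ℝ^ n → Set p} →
                               (∀ I → Definable (P I)) → Definable (λ v x → ∀ I → P I v x)
  definable-∀-NonemptySubset {P = P} P-def = definable-⇔
    {P = λ v x → ∀ I .(I≢∅ : Nonempty I) → P (I , [ I≢∅ ]) v x}
    (λ v x → mk⇔ (λ { P∀ (I , [ I≢∅ ]) → P∀ I I≢∅ }) (λ P∀ I .I≢∅ → P∀ (I , [ I≢∅ ])))
    (definable-∀-Subset λ I → definable-irrelevant-∀ (nonempty? I) λ .I≢∅ → P-def (I , [ I≢∅ ]))

  -- The slopes of the first variable are constants, hence their signs are admissible guards and
  -- `Eliminated` is again a finite system, in the remaining variables.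
  definable-∃-head : {P : (Fin (suc k) → Carrier) → ℝ^ n → Set p} →
                     Definable P → Definable (λ v x → ∃[ t ] P (t Vector.∷ v) x)
  definable-∃-head {k} {n} {P = P} (m , a , P⇔) = definable-⇔
    (λ v x → mk⇔
      (λ elim → let (t , h) = eliminated⇒feasible slope (rest v x) elim in
                t , from (P⇔ _ x) (λ i → ≼-respʳ-≈ (sym (split i t v x)) (h i)))
      (λ (t , Pt) → feasible⇒eliminated slope (rest v x)
                      (t , λ i → ≼-respʳ-≈ (split i t v x) (to (P⇔ _ x) Pt i))))
    (definable-×
      (definable-∀ λ i → definable-→ (slope i ≼? 0#) (definable-→ (0# ≼? slope i)
        (definable-nonNeg (linear-eval (tail i)))))
      (definable-∀ λ i → definable-∀ λ j → definable-→ (¬? (slope i ≼? 0#)) (definable-→ (¬? (0# ≼? slope j))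
        (definable-nonNeg (linear-+ (linear-*ˡ _ (linear-eval (tail j))) (linear-*ˡ _ (linear-eval (tail i))))))))
    where
    slope : Fin m → Carrier
    slope i = proj₁ (a i) zero
    tail : Fin m → Form k n
    tail i = Vector.tail (proj₁ (a i)) , proj₂ (a i)
    rest : (Fin k → Carrier) → ℝ^ n → Fin m → Carrier
    rest v x i = eval (tail i) v x
    split : ∀ i t v x → eval (a i) (t Vector.∷ v) x ≈ slope i * t + rest v x i
    split i t v x = +-assoc _ _ _

  definable-∃ : ∀ k {P : (Fin k → Carrier) → ℝ^ n → Set p} →
                Definable P → Definable {0} (λ _ x → ∃[ v ] P v x)
  definable-∃ zero    (m , a , P⇔) = m , a , λ v x →
    mk⇔ (λ (v′ , Pv′) → to (P⇔ v′ x) Pv′) (λ h → v , from (P⇔ v x) h)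
  definable-∃ (suc k) P-def@(m , a , P⇔) = definable-⇔
    (λ _ x → mk⇔
      (λ (v , t , Ptv) → (t Vector.∷ v) , Ptv)
      -- Head and tail reassemble to `v` only pointwise, so `P` is carried over through its defining
      -- system, whose forms evaluate alike on both.
      (λ (v , Pv) → Vector.tail v , Vector.head v ,
        from (P⇔ (Vector.head v Vector.∷ Vector.tail v) x) (to (P⇔ v x) Pv)))
    (definable-∃ k (definable-∃-head P-def))

  -- Cuts of ordered weights

  crossing : Bool → Bool → Carrier
  crossing true  true  = 0#
  crossing true  false = 1#
  crossing false true  = 1#
  crossing false false = 0#

  crossing-comm : ∀ a b → crossing a b ≈ crossing b a
  crossing-comm true  true  = refl
  crossing-comm true  false = refl
  crossing-comm false true  = refl
  crossing-comm false false = refl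

  crossing-refl : ∀ a → crossing a a ≈ 0#
  crossing-refl true  = refl
  crossing-refl false = refl

  -- Over all ordered pairs, loops included, so that weights can be moved along a vertex map that
  -- reverses or contracts edges. Loops add nothing, by `crossing-refl`.
  cut : (Fin N → Fin N → Carrier) → (Fin N → Bool) → Carrier
  cut u b = sum λ i → sum λ j → u i j * crossing (b i) (b j)

  cut-cong : {u u′ : Fin N → Fin N → Carrier} {b b′ : Fin N → Bool} →
             (∀ i j → u i j ≈ u′ i j) → (∀ i → b i ≡ b′ i) → cut u b ≈ cut u′ b′
  cut-cong u≈u′ b≗b′ = sum-cong-≋ λ i → sum-cong-≋ λ j →
    *-cong (u≈u′ i j) (reflexive (≡.cong₂ crossing (b≗b′ i) (b≗b′ j)))

  ∉⇒lookup : {W : Subset N} {i : Fin N} → i ∉ W → lookup W i ≡ false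
  ∉⇒lookup i∉W = Bool.¬-not (i∉W ∘ Vec.lookup⇒[]= _ _)

  when-crosses : ∀ t (W : Subset N) i j (i<j : i Fin.< j) →
                 (λ _ → t) when (((i , j) , [ i<j ]) ∈C?⟨ W ⟩) ≈ t * crossing (lookup W i) (lookup W j)
  when-crosses t W i j i<j with i ∈? W | j ∈? W
  ... | yes i∈W | yes j∈W rewrite Vec.[]=⇒lookup i∈W | Vec.[]=⇒lookup j∈W = sym (zeroʳ t)
  ... | yes i∈W | no j∉W  rewrite Vec.[]=⇒lookup i∈W | ∉⇒lookup j∉W = sym (*-identityʳ t)
  ... | no i∉W  | yes j∈W rewrite ∉⇒lookup i∉W | Vec.[]=⇒lookup j∈W = sym (*-identityʳ t)
  ... | no i∉W  | no j∉W  rewrite ∉⇒lookup i∉W | ∉⇒lookup j∉W = sym (zeroʳ t)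

  ordered : WeightMap N → Fin N → Fin N → Carrier
  ordered w i j = (λ i<j → WeightMap.weight w ((i , j) , [ i<j ])) when (i Fin.<? j)

  cut-ordered : (w : WeightMap N) (W : Subset N) → ‖C w ⟨ W ⟩‖ ≈ cut (ordered w) (lookup W)
  cut-ordered w W = sum-cong-≋ λ i → sum-cong-≋ λ j → entry i j
    where
    entry : ∀ i j → (λ i<j → (λ _ → WeightMap.weight w ((i , j) , [ i<j ])) when (((i , j) , [ i<j ]) ∈C?⟨ W ⟩)) when (i Fin.<? j)
                    ≈ ordered w i j * crossing (lookup W i) (lookup W j)
    entry i j with i Fin.<? j
    ... | yes i<j = when-crosses _ W i j i<j
    ... | no _    = sym (zeroˡ _)

  symmetrize : (u : Fin N → Fin N → Carrier) → (∀ i j → 0# ≼ u i j) → WeightMap N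
  symmetrize u 0≼u = record
    { weight = λ e → let (i , j) = value e in u i j + u j i
    ; nonNeg = λ e → nonNeg-+ (0≼u _ _) (0≼u _ _)
    }

  -- An edge carries the weights of both its orientations. Exchanging the two sums moves the
  -- reversed ones below the diagonal, and the diagonal itself never crosses.
  cut-symmetrize : (u : Fin N → Fin N → Carrier) (0≼u : ∀ i j → 0# ≼ u i j) (W : Subset N) →
                   ‖C symmetrize u 0≼u ⟨ W ⟩‖ ≈ cut u (lookup W)
  cut-symmetrize {N} u 0≼u W = begin
    ‖C symmetrize u 0≼u ⟨ W ⟩‖                                          ≈⟨ cut-ordered (symmetrize u 0≼u) W ⟩
    (sum λ i → sum λ j → ordered (symmetrize u 0≼u) i j * χ i j)          ≈⟨ sum-cong-≋ (λ i → sum-cong-≋ (λ j → divide i j)) ⟩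
    (sum λ i → sum λ j → above i j + below j i)                         ≈⟨ sum-cong-≋ (λ i → ∑-distrib-+ (above i) (λ j → below j i)) ⟩
    (sum λ i → sum (above i) + sum λ j → below j i)                     ≈⟨ ∑-distrib-+ (λ i → sum (above i)) _ ⟩
    (sum λ i → sum (above i)) + (sum λ i → sum λ j → below j i)         ≈⟨ +-congˡ (∑-comm (λ i j → below j i)) ⟩
    (sum λ i → sum (above i)) + (sum λ i → sum (below i))               ≈⟨ ∑-distrib-+ (λ i → sum (above i)) _ ⟨
    (sum λ i → sum (above i) + sum (below i))                           ≈⟨ sum-cong-≋ (λ i → ∑-distrib-+ (above i) (below i)) ⟨
    (sum λ i → sum λ j → above i j + below i j)                         ≈⟨ sum-cong-≋ (λ i → sum-cong-≋ (λ j → recombine i j)) ⟩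
    cut u (lookup W)                                                    ∎
    where
    χ above below : Fin N → Fin N → Carrier
    χ i j = crossing (lookup W i) (lookup W j)
    above i j = (λ _ → u i j * χ i j) when (i Fin.<? j)
    below i j = (λ _ → u i j * χ i j) when (j Fin.<? i)
    divide : ∀ i j → ordered (symmetrize u 0≼u) i j * χ i j ≈ above i j + below j i
    divide i j with i Fin.<? j
    ... | yes _ = trans (distribʳ _ _ _) (+-congˡ (*-congˡ (crossing-comm (lookup W i) (lookup W j))))
    ... | no _  = trans (zeroˡ _) (sym (+-identityˡ 0#))
    recombine : ∀ i j → above i j + below i j ≈ u i j * χ i j
    recombine i j with i Fin.<? j | j Fin.<? i
    ... | yes i<j | yes j<i = contradiction j<i (ℕ.<-asym i<j)
    ... | yes _   | no _    = +-identityʳ _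
    ... | no _    | yes _   = +-identityˡ _
    ... | no i≮j  | no j≮i  with Fin.toℕ-injective (ℕ.≤-antisym (ℕ.≮⇒≥ j≮i) (ℕ.≮⇒≥ i≮j))
    ...   | ≡.refl = trans (+-identityˡ 0#) (sym (trans (*-congˡ (crossing-refl (lookup W i))) (zeroʳ _)))

  module _ {N M : ℕ} (φ : Fin N → Fin M) where

    push : (Fin N → Carrier) → Fin M → Carrier
    push g a = sum λ i → (λ _ → g i) when (φ i Fin.≟ a)

    push-nonNeg : ∀ g → (∀ i → 0# ≼ g i) → ∀ a → 0# ≼ push g a
    push-nonNeg g 0≼g a = nonNeg-sum _ λ i → when-nonNeg (φ i Fin.≟ a) _ λ _ → 0≼g i

    -- Change of variables for an image measure: after the exchange of sums only a = `φ i`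
    -- contributes. `cut-pushforward` applies this to each endpoint in turn.
    sum-push : ∀ g (h : Fin M → Carrier) → (sum λ a → push g a * h a) ≈ sum λ i → g i * h (φ i)
    sum-push g h = begin
      (sum λ a → push g a * h a)                  ≈⟨ sum-cong-≋ (λ a → *-distribʳ-sum (h a) (λ i → (λ _ → g i) when (φ i Fin.≟ a))) ⟩
      (sum λ a → sum λ i → entry i a)             ≈⟨ ∑-comm (λ a i → entry i a) ⟩
      (sum λ i → sum λ a → entry i a)             ≈⟨ sum-cong-≋ (λ i → trans (sum-concentrated (entry i) (φ i) (off i)) (on i)) ⟩
      (sum λ i → g i * h (φ i))                   ∎
      where
      entry : Fin N → Fin M → Carrier
      entry i a = ((λ _ → g i) when (φ i Fin.≟ a)) * h a
      off : ∀ i a → φ i ≢ a → entry i a ≈ 0#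
      off i a φi≢a with φ i Fin.≟ a
      ... | yes φi≡a = contradiction φi≡a φi≢a
      ... | no _     = zeroˡ _
      on : ∀ i → entry i (φ i) ≈ g i * h (φ i)
      on i with φ i Fin.≟ φ i
      ... | yes _    = refl
      ... | no φi≢φi = contradiction ≡.refl φi≢φi

    pushforward : (Fin N → Fin N → Carrier) → Fin M → Fin M → Carrier
    pushforward u a b = push (λ i → push (u i) b) a

    cut-pushforward : ∀ u (b : Fin M → Bool) → cut (pushforward u) b ≈ cut u (b ∘ φ)
    cut-pushforward u b = begin
      (sum λ a → sum λ a′ → pushforward u a a′ * crossing (b a) (b a′))        ≈⟨ ∑-comm (λ a a′ → pushforward u a a′ * crossing (b a) (b a′)) ⟩
      (sum λ a′ → sum λ a → pushforward u a a′ * crossing (b a) (b a′))        ≈⟨ sum-cong-≋ (λ a′ → sum-push (λ i → push (u i) a′) (λ a → crossing (b a) (b a′))) ⟩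
      (sum λ a′ → sum λ i → push (u i) a′ * crossing (b (φ i)) (b a′))         ≈⟨ ∑-comm (λ a′ i → push (u i) a′ * crossing (b (φ i)) (b a′)) ⟩
      (sum λ i → sum λ a′ → push (u i) a′ * crossing (b (φ i)) (b a′))         ≈⟨ sum-cong-≋ (λ i → sum-push (u i) (λ a′ → crossing (b (φ i)) (b a′))) ⟩
      cut u (b ∘ φ)                                                            ∎

  -- The min-cut vectors as a projection of a polyhedral cone

  matrix : (Fin (N ℕ.* N) → Carrier) → Fin N → Fin N → Carrier
  matrix v i j = v (combine i j)

  -- The canonical cut also separates, so the last two clauses together make `x I` equal to its
  -- value.
  CanonicallyRealizes : (Fin (order n ℕ.* order n) → Carrier) → ℝ^ n → Set ℓ₂
  CanonicallyRealizes {n} v x =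
    (∀ e → 0# ≼ v e) ×
    (∀ I → cut (matrix v) (lookup (canonical-cut (value I))) ≼ x I) ×
    (∀ I W → Separates (n<order n) (value I) W → x I ≼ cut (matrix v) (lookup W))

  linear-cut : (b : Fin N → Bool) → Linear {N ℕ.* N} {n} (λ v x → cut (matrix v) b)
  linear-cut b = linear-sum λ i → linear-sum λ j →
    linear-cong (λ v x → *-comm _ _) (linear-*ˡ (crossing (b i) (b j)) (linear-variable (combine i j)))

  canonicallyRealizes-definable : ∀ n → Definable (CanonicallyRealizes {n})
  canonicallyRealizes-definable n = definable-×
    (definable-∀ λ e → definable-nonNeg (linear-variable e))
    (definable-×
      (definable-∀-NonemptySubset λ I → definable-≼ (linear-cut (lookup (canonical-cut (value I)))) (linear-coordinate I))
      (definable-∀-NonemptySubset λ I → definable-∀-Subset λ W →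
        definable-→ (separates? (n<order n) (value I) W) (definable-≼ (linear-coordinate I) (linear-cut (lookup W)))))

  canonicallyRealizes⇒H : {x : ℝ^ n} → ∃[ v ] CanonicallyRealizes v x → H n x
  canonicallyRealizes⇒H {n} {x} (v , 0≼v , attained , minimal) =
    order n , n<order n , w , λ I →
      (canonical-cut (value I) , canonical-cut-separates (value I) ,
        antisym (min I _ (canonical-cut-separates (value I)))
                (≼-respˡ-≈ (sym (cut-w (canonical-cut (value I)))) (attained I))) ,
      min I
    where
    w = symmetrize (matrix v) (λ i j → 0≼v (combine i j))
    cut-w = cut-symmetrize (matrix v) (λ i j → 0≼v (combine i j))
    min : ∀ I W → Separates (n<order n) (value I) W → x I ≼ ‖C w ⟨ W ⟩‖
    min I W sep = ≼-respʳ-≈ (sym (cut-w W)) (minimal I W sep)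

  -- The given weights are pushed along `collapse`. The canonical cut of I then has the value of the
  -- chosen minimum cut, and every separating cut has the value of its preimage, which is separating
  -- too.
  H⇒canonicallyRealizes : {x : ℝ^ n} → H n x → ∃[ v ] CanonicallyRealizes v x
  H⇒canonicallyRealizes {n} {x} (N , n<N , w , realizes) =
    v , (λ e → u′-nonNeg _ _) , attained , minimal
    where
    minCut : ∀ I → Dec (Nonempty I) → Subset N
    minCut I (yes I≢∅) = proj₁ (proj₁ (realizes (I , [ I≢∅ ])))
    -- The empty set indexes no coordinate, so this default is arbitrary.
    minCut I (no _)    = ⊥
    W : Subset n → Subset N
    W I = minCut I (nonempty? I)
    W-minimum : ∀ I → Separates n<N (value I) (W (value I)) × x I ≈ ‖C w ⟨ W (value I) ⟩‖
    W-minimum (I , [ I≢∅ ]) with nonempty? I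
    ... | yes p   = proj₂ (proj₁ (realizes (I , [ p ])))
    ... | no I≡∅ = contradiction-irr I≢∅ I≡∅
    open Collapse n<N W
    ordered-nonNeg : ∀ i j → 0# ≼ ordered w i j
    ordered-nonNeg i j = when-nonNeg (i Fin.<? j) _ λ i<j → WeightMap.nonNeg w ((i , j) , [ i<j ])
    u′ : Fin (order n) → Fin (order n) → Carrier
    u′ = pushforward collapse (ordered w)
    u′-nonNeg : ∀ a b → 0# ≼ u′ a b
    u′-nonNeg a b = push-nonNeg collapse _ (λ i → push-nonNeg collapse _ (ordered-nonNeg i) b) a
    v : Fin (order n ℕ.* order n) → Carrier
    v e = uncurry u′ (remQuot (order n) e)
    cut-v : ∀ (U : Subset (order n)) (V : Subset N) → (∀ i → lookup U (collapse i) ≡ lookup V i) →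
            cut (matrix v) (lookup U) ≈ ‖C w ⟨ V ⟩‖
    cut-v U V U∘collapse≗V = begin
      cut (matrix v) (lookup U)                 ≈⟨ cut-cong {b = lookup U} (λ i j → reflexive (≡.cong (uncurry u′) (Fin.remQuot-combine i j))) (λ _ → ≡.refl) ⟩
      cut u′ (lookup U)                         ≈⟨ cut-pushforward collapse (ordered w) (lookup U) ⟩
      cut (ordered w) (lookup U ∘ collapse)     ≈⟨ cut-cong (λ _ _ → refl) U∘collapse≗V ⟩
      cut (ordered w) (lookup V)                ≈⟨ cut-ordered w V ⟨
      ‖C w ⟨ V ⟩‖                               ∎
    attained : ∀ I → cut (matrix v) (lookup (canonical-cut (value I))) ≼ x I
    attained I = ≼-reflexive (trans
      (cut-v (canonical-cut (value I)) (W (value I)) (preimage-canonical-cut (proj₁ (W-minimum I))))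
      (sym (proj₂ (W-minimum I))))
    minimal : ∀ I U → Separates (n<order n) (value I) U → x I ≼ cut (matrix v) (lookup U)
    minimal I U sep = ≼-respʳ-≈
      (sym (cut-v U (preimage U) (λ i → ≡.sym (Vec.lookup∘tabulate (lookup U ∘ collapse) i))))
      (proj₂ (realizes I) (preimage U) (preimage-separates sep))

  H-polyhedral : ∀ n → Polyhedral (H n)
  H-polyhedral n =
    let (m , a , iff) = definable-∃ (order n ℕ.* order n) (canonicallyRealizes-definable n) in
    m , proj₂ ∘ a ,
    -- With all variables eliminated, a form is `0#` plus its pairing with `x`.
    (λ {x} Hx i → ≼-respʳ-≈ (+-identityˡ _) (to (iff (λ ()) x) (H⇒canonicallyRealizes Hx) i)) ,
    (λ {x} 0≼ → canonicallyRealizes⇒H (from (iff (λ ()) x) (λ i → ≼-respʳ-≈ (sym (+-identityˡ _)) (0≼ i))))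

  -- Closure under nonnegative combinations

  -- Lengths 0, 1 and 2 give the zero vector, scaling and convexity; arbitrary length absorbs convex
  -- hulls.
  ConicallyClosed : Pred (ℝ^ n) p → Set (c ⊔ ℓ₁ ⊔ ℓ₂ ⊔ p)
  ConicallyClosed {n} X = ∀ {k} (t : Fin k → Carrier) (y : Fin k → ℝ^ n) {x} →
    (∀ i → 0# ≼ t i) → (∀ i → X (y i)) → (∀ I → x I ≈ sum λ i → t i * y i I) → X x

  polyhedral⇒conicallyClosed : {X : Pred (ℝ^ n) p} → Polyhedral X → ConicallyClosed X
  polyhedral⇒conicallyClosed (_ , a , X⊆ , ⊆X) t y {x} 0≼t Xy x≈ = ⊆X λ j →
    ≼-respʳ-≈
      (sym (begin
        ⟪ a j , x ⟫                                ≈⟨ ⟪⟫-cong {a = a j} x≈ ⟩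
        ⟪ a j , (λ I → sum λ i → t i * y i I) ⟫    ≈⟨ ⟪⟫-sumʳ (a j) (λ i I → t i * y i I) ⟩
        (sum λ i → ⟪ a j , (λ I → t i * y i I) ⟫)  ≈⟨ sum-cong-≋ (λ i → ⟪⟫-*ʳ (t i) (a j) (y i)) ⟩
        (sum λ i → t i * ⟪ a j , y i ⟫)            ∎))
      (nonNeg-sum _ λ i → *-nonNeg (0≼t i) (X⊆ (Xy i) j))

  polyhedral⇒isConvexPolyhedralCone : {X : Pred (ℝ^ n) p} → Polyhedral X → IsConvexPolyhedralCone X
  polyhedral⇒isConvexPolyhedralCone {X = X} X-polyhedral = record
    { convex     = λ {x} {y} t Xx Xy 0≼t t≼1 →
        closed (t Vector.∷ (1# + - t) Vector.∷ Vector.[]) (x Vector.∷ y Vector.∷ Vector.[])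
          (λ { zero → 0≼t ; (suc zero) → ≼⇒nonNeg-difference t≼1 })
          (λ { zero → Xx ; (suc zero) → Xy })
          (λ I → +-congˡ (sym (+-identityʳ _)))
    ; cone       =
        ((λ _ → 0#) , closed Vector.[] Vector.[] (λ ()) (λ ()) (λ _ → refl)) ,
        (λ {x} t 0≼t Xx → closed {1} (λ _ → t) (λ _ → x) (λ _ → 0≼t) (λ _ → Xx) (λ I → sym (+-identityʳ _)))
    ; polyhedral = X-polyhedral
    }
    where
    closed : ConicallyClosed X
    closed = polyhedral⇒conicallyClosed X-polyhedral

  ⊆-convexHull : {X : Pred (ℝ^ n) p} → X ⊆ ConvexHull X
  ⊆-convexHull {x = x} Xx = 1 , (λ _ → 1#) , (λ _ → x) , (λ _ → 0≼1) , +-identityʳ 1# , (λ _ → Xx) ,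
    λ I → sym (trans (+-identityʳ _) (*-identityˡ (x I)))

  -- By the choice of m every vector of `H n` is itself a generator of the hull; conversely the
  -- generators lie in `H n`, which is conically closed.
  H≐H[m,n] : ∀ m (is-m : Is-m⟨ n ⟩ m) → H n ≐ H[ m , n ] (Is-m⟨_⟩.n<m is-m)
  H≐H[m,n] {n} m is-m =
    (λ Hx → ⊆-convexHull (Is-m⟨_⟩.realizes is-m Hx)) ,
    (λ (_ , t , y , 0≼t , _ , realizable , x≈) →
      polyhedral⇒conicallyClosed (H-polyhedral n) t y 0≼t (λ i → m , Is-m⟨_⟩.n<m is-m , realizable i) x≈)

corollary2 : ∀ {c ℓ₁ ℓ₂} (ℝ : CompleteOrderedField c ℓ₁ ℓ₂) →
    let open MinCuts (CompleteOrderedField.orderedField ℝ) in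
    ∀ (n : ℕ) → 1 ≤ n →
    IsConvexPolyhedralCone (H n) ×
    (∀ (m : ℕ) (is-m : Is-m⟨ n ⟩ m) → H n ≐ H[ m , n ] (Is-m⟨_⟩.n<m is-m))
corollary2 ℝ n _ = polyhedral⇒isConvexPolyhedralCone (H-polyhedral n) , H≐H[m,n]
  where open CutCone (CompleteOrderedField.orderedField ℝ)
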